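{- Let $G$ be a simple, undirected, finite graph with $n\geq 1$ vertices and maximum degree $\Delta(G)$, and let $k$ be a positive integer. For every initial configuration $x(0)$ of the $k$-reversible process on $G$, the transient length satisfies $\tau(x(0))\leq n(\Delta(G)+1)-1$.
   Context: Let $V(G)=\{v_1,\dots,v_n\}$. A configuration is an assignment of a state in $\{ -1,+1\}$ to each vertex. In the $k$-reversible process on $G$ with initial configuration $x(0)$, $x_i(t)$ denotes the state of $v_i$ at discrete time $t=0,1,2,\dots$, and $x(t)=(x_1(t),\dots,x_n(t))$. Let $\mathit{op}_i(t)$ be the number of neighbors of $v_i$ whose state at time $t$ is different from $x_i(t)$. All vertices are updated simultaneously: $x_i(t+1)=-x_i(t)$ if $\mathit{op}_i(t)\geq k$, and $x_i(t+1)=x_i(t)$ otherwise. The period length $p(x(0))\ge 1$ and the transient length $\tau(x(0))\geq 0$ are the integers such that: $x(t+p(x(0)))=x(t)$ for all $t\geq\tau(x(0))$; and, for integers $t\ge 0$ and $q\geq 1$, $x(t+q)\neq x(t)$ whenever $t<\tau(x(0))$ or $q<p(x(0))$. -}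

module Defs where

open import Data.Bool.Base using (if_then_else_)
open import Data.Fin.Base using (Fin; toℕ; funToFin; finToFun)
open import Data.Fin.Properties using (finToFun-funToFin; pigeonhole; toℕ<n)
import Data.List.Base as List
open import Data.List.Extrema.Nat using (max)
open import Data.Nat.Base using (ℕ; zero; suc; _+_; _*_; _∸_; _^_; _≤_; _<_; z≤n; s≤s; s≤s⁻¹)
open import Data.Nat.Induction using (<-rec)
open import Data.Nat.Properties
open import Data.Product.Base using (∃-syntax; _×_; _,_; proj₁; proj₂)
open import Data.Sign.Base using (Sign; opposite)
import Data.Sign.Base as Sign
import Data.Sign.Properties as Sign
open import Data.Sum.Base using (_⊎_; inj₁; inj₂)
open import Data.Vec.Base using (Vec; allFin; count; lookup; tabulate)
open import Data.Vec.Properties using (tabulate∘lookup; tabulate-cong; ≡-dec)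
open import Level using (0ℓ)
open import Relation.Binary.Core using (Rel)
open import Relation.Binary.Definitions using (Decidable; Irreflexive; Symmetric; DecidableEquality)
open import Relation.Binary.PropositionalEquality
open import Relation.Nullary using (¬_; yes; no; does; ¬?; _×-dec_; contradiction)
import Relation.Unary as Unary

-- The vertices v₁, …, vₙ are the elements of Fin n.
record Graph (n : ℕ) : Set₁ where
  field
    Adj    : Rel (Fin n) 0ℓ
    adj?   : Decidable Adj
    symm   : Symmetric Adj
    irrefl : Irreflexive _≡_ Adj

open Graph public

degree : ∀ {n} → Graph n → Fin n → ℕ
degree G i = count (adj? G i) (allFin _)

-- The first argument of max is a default value, neutral for natural numbers.
Δ : ∀ {n} → Graph n → ℕ
Δ G = max 0 (List.tabulate (degree G))

-- The states -1 and +1 are the two elements of Sign, and opposite is negation.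

Configuration : ℕ → Set
Configuration n = Vec Sign n

op : ∀ {n} → Graph n → Configuration n → Fin n → ℕ
op G x i =
  count (λ j → adj? G i j ×-dec ¬? (lookup x j Sign.≟ lookup x i)) (allFin _)

step : ∀ {n} → Graph n → ℕ → Configuration n → Configuration n
step G k x = tabulate λ i →
  if does (k ≤? op G x i) then opposite (lookup x i) else lookup x i

process : ∀ {n} → Graph n → ℕ → Configuration n → ℕ → Configuration n
process G k x₀ zero    = x₀
process G k x₀ (suc t) = step G k (process G k x₀ t)

record IsPeriodTransient {A : Set} (x : ℕ → A) (p τ : ℕ) : Set where
  field
    p≥1      : 1 ≤ p
    periodic : ∀ t → τ ≤ t → x (t + p) ≡ x t
    minimal  : ∀ t q → 1 ≤ q → t < τ ⊎ q < p → x (t + q) ≢ x t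

periodTransient-unique : ∀ {A : Set} {x : ℕ → A} {p p′ τ τ′} →
  IsPeriodTransient x p τ → IsPeriodTransient x p′ τ′ → p ≡ p′ × τ ≡ τ′
periodTransient-unique I J =
  ≤-antisym (p-bound I J) (p-bound J I) , ≤-antisym (τ-bound I J) (τ-bound J I)
  where
  open IsPeriodTransient
  p-bound : ∀ {A : Set} {x : ℕ → A} {p p′ τ τ′} →
            IsPeriodTransient x p τ → IsPeriodTransient x p′ τ′ → p ≤ p′
  p-bound I J = ≮⇒≥ λ p′<p →
    minimal I _ _ (p≥1 J) (inj₂ p′<p) (periodic J _ ≤-refl)
  τ-bound : ∀ {A : Set} {x : ℕ → A} {p p′ τ τ′} →
            IsPeriodTransient x p τ → IsPeriodTransient x p′ τ′ → τ ≤ τ′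
  τ-bound I J = ≮⇒≥ λ τ′<τ →
    minimal I _ _ (p≥1 J) (inj₁ τ′<τ) (periodic J _ ≤-refl)

private
  least : ∀ {P : ℕ → Set} → Unary.Decidable P → ∀ n → P n →
          ∃[ m ] P m × (∀ j → j < m → ¬ P j)
  least {P} P? = <-rec (λ n → P n → ∃[ m ] P m × (∀ j → j < m → ¬ P j)) go
    where
    go : ∀ n → (∀ {m} → m < n → P m → ∃[ m ] P m × (∀ j → j < m → ¬ P j)) →
         P n → ∃[ m ] P m × (∀ j → j < m → ¬ P j)
    go n rec Pn with anyUpTo? P? n
    ... | yes (m , m<n , Pm) = rec m<n Pm
    ... | no ∄               = n , Pn , λ j j<n Pj → ∄ (j , j<n , Pj)

-- The encoding into Fin N makes A finite, which is what forces the orbit of f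
-- to be eventually periodic.
module _ {A : Set} (_≟ᴬ_ : DecidableEquality A)
         {N : ℕ} (enc : A → Fin N) (enc-inj : ∀ {a b} → enc a ≡ enc b → a ≡ b)
         (f : A → A) (x : ℕ → A) (x-suc : ∀ t → x (suc t) ≡ f (x t)) where

  private
    shift : ∀ {a b} → x a ≡ x b → ∀ c → x (c + a) ≡ x (c + b)
    shift eq zero    = eq
    shift eq (suc c) =
      trans (x-suc _) (trans (cong f (shift eq c)) (sym (x-suc _)))

    shiftʳ : ∀ {a b} → x a ≡ x b → ∀ c → x (a + c) ≡ x (b + c)
    shiftʳ {a} {b} eq c =
      subst₂ (λ u v → x u ≡ x v) (+-comm c a) (+-comm c b) (shift eq c)

    collision : ∀ t → ∃[ i ] ∃[ d ] i + suc d ≤ N × x (t + (i + suc d)) ≡ x (t + i)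
    collision t with pigeonhole (n<1+n N) (λ i → enc (x (t + toℕ i)))
    ... | i , j , i<j , eq =
      toℕ i , toℕ j ∸ suc (toℕ i)
      , subst (_≤ N) (sym j≡) (s≤s⁻¹ (toℕ<n j))
      , trans (cong (λ s → x (t + s)) j≡) (sym (enc-inj eq))
      where
      j≡ : toℕ i + suc (toℕ j ∸ suc (toℕ i)) ≡ toℕ j
      j≡ = trans (+-suc _ _) (m+[n∸m]≡n i<j)

    Return : ℕ → ℕ → Set
    Return t q = x (t + suc q) ≡ x t

    return? : ∀ t → Unary.Decidable (Return t)
    return? t q = x (t + suc q) ≟ᴬ x t

    Recurrent : ℕ → Set
    Recurrent t = ∃[ q ] q < N × Return t q

    -- The first return to x t happens within N steps: a longer one could be
    -- shortened at a collision.
    return⇒recurrent : ∀ t q → Return t q → Recurrent t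
    return⇒recurrent t q r with least (return? t) q r
    ... | m , rm , m-least with <-≤-connex m N
    ...   | inj₁ m<N = m , m<N , rm
    ...   | inj₂ N≤m with collision t
    ...     | i , d , i+d≤N , eq = contradiction shorter (m-least m′ m′<m)
      where
      e = m ∸ (i + suc d)
      m′ = i + e

      m≡ : i + suc d + e ≡ m
      m≡ = m+[n∸m]≡n (≤-trans i+d≤N N≤m)

      m′<m : m′ < m
      m′<m = subst (m′ <_) m≡
        (+-monoˡ-< e (≤-trans (n<1+n i) (subst (suc i ≤_) (sym (+-suc i d)) (s≤s (m≤m+n i d)))))

      open ≡-Reasoning
      shorter : Return t m′
      shorter = begin
        x (t + suc (i + e))            ≡⟨ cong (λ s → x (t + s)) (+-suc i e) ⟨
        x (t + (i + suc e))            ≡⟨ cong x (+-assoc t i (suc e)) ⟨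
        x (t + i + suc e)              ≡⟨ shiftʳ eq (suc e) ⟨
        x (t + (i + suc d) + suc e)    ≡⟨ cong x (+-assoc t (i + suc d) (suc e)) ⟩
        x (t + (i + suc d + suc e))    ≡⟨ cong (λ s → x (t + s)) (+-suc (i + suc d) e) ⟩
        x (t + suc (i + suc d + e))    ≡⟨ cong (λ s → x (t + suc s)) m≡ ⟩
        x (t + suc m)                  ≡⟨ rm ⟩
        x t                            ∎

    someRecurrent : ∃[ t ] Recurrent t
    someRecurrent with collision 0
    ... | i , d , _ , eq = i , return⇒recurrent i d eq

    pushReturn : ∀ {s q} → x (s + q) ≡ x s → ∀ c → x (s + c + q) ≡ x (s + c)
    pushReturn {s} {q} eq c = begin
      x (s + c + q)     ≡⟨ cong x (+-assoc s c q) ⟩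
      x (s + (c + q))   ≡⟨ cong (λ u → x (s + u)) (+-comm c q) ⟩
      x (s + (q + c))   ≡⟨ cong x (+-assoc s q c) ⟨
      x (s + q + c)     ≡⟨ shiftʳ eq c ⟩
      x (s + c)         ∎
      where open ≡-Reasoning

    multiples : ∀ {s p} → x (s + p) ≡ x s → ∀ m → x (s + m * p) ≡ x s
    multiples {s} {p} eq zero    = cong x (+-identityʳ s)
    multiples {s} {p} eq (suc m) = trans (cong x (sym (+-assoc s p (m * p))))
      (trans (shiftʳ eq (m * p)) (multiples eq m))

    -- A period of the orbit from time s + c is already a period from time s,
    -- since the orbit comes back to x s after time s + c.
    pullReturn : ∀ {s d q} → Return s d → ∀ c → x (s + c + q) ≡ x (s + c) → x (s + q) ≡ x s
    pullReturn {s} {d} {q} r c eq = begin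
      x (s + q)             ≡⟨ shiftʳ (multiples r c) q ⟨
      x (s + c * suc d + q) ≡⟨ cong (λ u → x (u + q)) cd≡ ⟩
      x (s + c + e + q)     ≡⟨ pushReturn eq e ⟩
      x (s + c + e)         ≡⟨ cong x cd≡ ⟨
      x (s + c * suc d)     ≡⟨ multiples r c ⟩
      x s                   ∎
      where
      open ≡-Reasoning
      e = c * suc d ∸ c
      cd≡ : s + c * suc d ≡ s + c + e
      cd≡ = trans (cong (s +_) (sym (m+[n∸m]≡n (m≤m*n c (suc d))))) (sym (+-assoc s c e))

  orbit-periodTransient : ∃[ p ] ∃[ τ ] IsPeriodTransient x p τ
  orbit-periodTransient
    with least (λ t → anyUpTo? (return? t) N) (proj₁ someRecurrent) (proj₂ someRecurrent)
  ... | τ , (q , _ , r) , τ-least with least (return? τ) q r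
  ...   | d , rd , d-least = suc d , τ , record
    { p≥1      = s≤s z≤n
    ; periodic = λ t τ≤t → subst (λ u → x (u + suc d) ≡ x u) (m+[n∸m]≡n τ≤t)
                             (pushReturn rd (t ∸ τ))
    ; minimal  = minimal
    }
    where
    minimal : ∀ t q → 1 ≤ q → t < τ ⊎ q < suc d → x (t + q) ≢ x t
    minimal t (suc q) _ t<τ⊎q<d eq with <-≤-connex t τ
    ... | inj₁ t<τ = τ-least t t<τ (return⇒recurrent t q eq)
    ... | inj₂ τ≤t with t<τ⊎q<d
    ...   | inj₁ t<τ = <⇒≱ t<τ τ≤t
    ...   | inj₂ q<d = d-least q (s≤s⁻¹ q<d)
      (pullReturn rd (t ∸ τ)
        (subst (λ u → x (u + suc q) ≡ x u) (sym (m+[n∸m]≡n τ≤t)) eq))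

private
  signToFin : Sign → Fin 2
  signToFin Sign.- = Fin.zero
  signToFin Sign.+ = Fin.suc Fin.zero

  signToFin-inj : ∀ {s t} → signToFin s ≡ signToFin t → s ≡ t
  signToFin-inj {Sign.-} {Sign.-} _ = refl
  signToFin-inj {Sign.+} {Sign.+} _ = refl

  encode : ∀ {n} → Configuration n → Fin (2 ^ n)
  encode x = funToFin (λ i → signToFin (lookup x i))

  encode-inj : ∀ {n} {x y : Configuration n} → encode x ≡ encode y → x ≡ y
  encode-inj {x = x} {y} eq = trans (sym (tabulate∘lookup x))
    (trans (tabulate-cong λ i → signToFin-inj
             (trans (sym (finToFun-funToFin (λ i → signToFin (lookup x i)) i))
               (trans (cong (λ c → finToFun c i) eq)
                 (finToFun-funToFin (λ i → signToFin (lookup y i)) i))))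
      (tabulate∘lookup y))

module _ {n : ℕ} (G : Graph n) (k : ℕ) (x₀ : Configuration n) where

  process-periodTransient : ∃[ p ] ∃[ τ ] IsPeriodTransient (process G k x₀) p τ
  process-periodTransient =
    orbit-periodTransient (≡-dec Sign._≟_) encode encode-inj
      (step G k) (process G k x₀) (λ _ → refl)

  periodLength : ℕ
  periodLength = proj₁ process-periodTransient

  transientLength : ℕ
  transientLength = proj₁ (proj₂ process-periodTransient)

  periodLength-transientLength :
    IsPeriodTransient (process G k x₀) periodLength transientLength
  periodLength-transientLength = proj₂ (proj₂ process-periodTransient)

{-# OPTIONS --safe #-}

-- Let k = m + 1. Give the choice of state s for vertex i, when the current
-- configuration is x, the cost
--   #{neighbours j of i with x j ≠ s} + (degree i if s = x i, else 2k - 1).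
-- The next state of i is the strict minimiser of this cost, because keeping
-- costs op + d, flipping costs (d - op) + (2k - 1), and 2 op ≠ 2k − 1.
-- The total cost F(x, y) of moving from x to y is symmetric in x and y, so
-- F(x(t+1), x(t+2)) ≤ F(x(t+1), x(t)) = F(x(t), x(t+1)), strictly unless
-- x(t+2) = x(t), which cannot happen during the transient. The minimal cost
-- at i lies in an interval of length degree i, so τ ≤ ∑ degree i ≤ n Δ.
module Submission where

open import Defs
import Algebra.Properties.CommutativeMonoid.Sum
open import Data.Bool.Base using (Bool; true; false; not; _∧_; if_then_else_)
open import Data.Fin.Base using (Fin; zero; suc)
open import Data.Fin.Properties using (¬∀⟶∃¬)
open import Data.List.Extrema.Nat using (xs≤max)
open import Data.List.Relation.Unary.All.Properties using (tabulate⁻)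
open import Data.Nat.Base using (ℕ; zero; suc; _+_; _*_; _∸_; _≤_; _<_; _⊓_; z≤n; s≤s; s≤s⁻¹)
open import Data.Nat.Properties
open import Data.Product.Base using (∃-syntax; _,_)
open import Data.Sign.Base using (Sign; opposite)
import Data.Sign.Base as Sign
import Data.Sign.Properties as Sign
open import Data.Sum.Base using (inj₁)
open import Data.Vec.Base using (Vec; count; lookup; tabulate)
open import Data.Vec.Properties using (lookup∘tabulate; tabulate∘lookup; tabulate-cong)
open import Function.Base using (id; _∘_)
open import Function.Bundles using (mk⇔)
open import Relation.Binary.PropositionalEquality
open import Relation.Nullary using (Dec; yes; no; does; ¬?; _×-dec_; contradiction)
open import Relation.Nullary.Decidable using (does-⇔)
import Relation.Unary as Unary

open Algebra.Properties.CommutativeMonoid.Sum +-0-commutativeMonoid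
  using (sum; sum-syntax; sum-cong-≗; ∑-distrib-+; ∑-comm)

-- Finite sums, counts and state vectors

sum-mono-≤ : ∀ {n} {f g : Fin n → ℕ} → (∀ i → f i ≤ g i) → sum f ≤ sum g
sum-mono-≤ {zero}  f≤g = z≤n
sum-mono-≤ {suc n} f≤g = +-mono-≤ (f≤g zero) (sum-mono-≤ (f≤g ∘ suc))

sum-mono-< : ∀ {n} {f g : Fin n → ℕ} → (∀ i → f i ≤ g i) →
             ∀ i → f i < g i → sum f < sum g
sum-mono-< f≤g zero    f<g = +-mono-<-≤ f<g (sum-mono-≤ (f≤g ∘ suc))
sum-mono-< f≤g (suc i) f<g = +-mono-≤-< (f≤g zero) (sum-mono-< (f≤g ∘ suc) i f<g)

sum-≤-* : ∀ {n} {f : Fin n → ℕ} c → (∀ i → f i ≤ c) → sum f ≤ n * c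
sum-≤-* {zero}  c f≤c = z≤n
sum-≤-* {suc n} c f≤c = +-mono-≤ (f≤c zero) (sum-≤-* c (f≤c ∘ suc))

bit : Bool → ℕ
bit b = if b then 1 else 0

-- Turns the counts in `op` and `degree` into sums of bits, so that they can be added and their
-- order of summation exchanged.
count-tabulate : ∀ {A : Set} {P : A → Set} (P? : Unary.Decidable P) {n} (f : Fin n → A) →
                 count P? (tabulate f) ≡ ∑[ i < n ] bit (does (P? (f i)))
count-tabulate P? {zero}  f = refl
count-tabulate P? {suc n} f with does (P? (f zero))
... | true  = cong suc (count-tabulate P? (f ∘ suc))
... | false = count-tabulate P? (f ∘ suc)

-- There are finitely many positions and equality of states is decidable, so a differing position
-- can be found constructively.
lookup-≢ : ∀ {n} {x y : Vec Sign n} → x ≢ y → ∃[ i ] lookup x i ≢ lookup y i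
lookup-≢ {n} {x} {y} x≢y =
  ¬∀⟶∃¬ n (λ i → lookup x i ≡ lookup y i) (λ i → lookup x i Sign.≟ lookup y i) λ eq →
    x≢y (trans (sym (tabulate∘lookup x)) (trans (tabulate-cong eq) (tabulate∘lookup y)))

≢⇒≡opposite : ∀ {s t} → s ≢ t → s ≡ opposite t
≢⇒≡opposite {Sign.-} {Sign.-} s≢t = contradiction refl s≢t
≢⇒≡opposite {Sign.-} {Sign.+} s≢t = refl
≢⇒≡opposite {Sign.+} {Sign.-} s≢t = refl
≢⇒≡opposite {Sign.+} {Sign.+} s≢t = contradiction refl s≢t

degree≤Δ : ∀ {n} (G : Graph n) i → degree G i ≤ Δ G
degree≤Δ G = tabulate⁻ (xs≤max 0 _)

-- Disagreement with neighbours

module _ {n : ℕ} (G : Graph n) (m : ℕ) where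

  -- The Boolean to which the decision in `op` reduces, with an arbitrary state `s` in place of the
  -- vertex's own.
  disagrees : Configuration n → (i : Fin n) → Sign → Fin n → Bool
  disagrees x i s j = does (adj? G i j) ∧ not (does (lookup x j Sign.≟ s))

  mismatch : Configuration n → Fin n → Sign → ℕ
  mismatch x i s = ∑[ j < n ] bit (disagrees x i s j)

  op≡mismatch : ∀ x i → op G x i ≡ mismatch x i (lookup x i)
  op≡mismatch x i = count-tabulate
    (λ j → adj? G i j ×-dec ¬? (lookup x j Sign.≟ lookup x i)) id

  -- There are only two states, so each neighbour disagrees with exactly one of `s` and
  -- `opposite s`.
  mismatch-opposite : ∀ x i s → mismatch x i s + mismatch x i (opposite s) ≡ degree G i
  mismatch-opposite x i s = begin
    mismatch x i s + mismatch x i (opposite s)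
      ≡⟨ ∑-distrib-+ (bit ∘ disagrees x i s) (bit ∘ disagrees x i (opposite s)) ⟨
    ∑[ j < n ] (bit (disagrees x i s j) + bit (disagrees x i (opposite s) j))
      ≡⟨ sum-cong-≗ (λ j → split (does (adj? G i j)) (lookup x j) s) ⟩
    ∑[ j < n ] bit (does (adj? G i j))
      ≡⟨ count-tabulate (adj? G i) id ⟨
    degree G i ∎
    where
    open ≡-Reasoning
    split : ∀ b r s → bit (b ∧ not (does (r Sign.≟ s))) +
                      bit (b ∧ not (does (r Sign.≟ opposite s))) ≡ bit b
    split false r      s      = refl
    split true  Sign.- Sign.- = refl
    split true  Sign.- Sign.+ = refl
    split true  Sign.+ Sign.- = refl
    split true  Sign.+ Sign.+ = refl

  mismatch≤degree : ∀ x i s → mismatch x i s ≤ degree G i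
  mismatch≤degree x i s = subst (mismatch x i s ≤_) (mismatch-opposite x i s) (m≤m+n _ _)

  -- Both sides count ordered pairs of adjacent vertices, one with its state in `x` and the other
  -- with its state in `y`, whose states differ. Exchanging the sums and using symmetry of adjacency
  -- matches them.
  ∑-mismatch-comm : ∀ x y → ∑[ i < n ] mismatch x i (lookup y i) ≡
                            ∑[ i < n ] mismatch y i (lookup x i)
  ∑-mismatch-comm x y = trans (∑-comm (λ i j → bit (disagrees x i (lookup y i) j)))
    (sum-cong-≗ λ j → sum-cong-≗ λ i → cong₂ (λ a b → bit (a ∧ not b))
      (does-⇔ (mk⇔ (symm G) (symm G)) (adj? G i j) (adj? G j i))
      (does-⇔ (mk⇔ sym sym) (lookup x j Sign.≟ lookup y i) (lookup y i Sign.≟ lookup x j)))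

  -- Cost of a transition at one vertex

  -- With `k = suc m`, the sum `m + suc m` is `2k - 1`, split so that it compares summand by summand
  -- with `D + D` below.
  weight : Fin n → Sign → Sign → ℕ
  weight i r s = if does (r Sign.≟ s) then degree G i else m + suc m

  weight-refl : ∀ i s → weight i s s ≡ degree G i
  weight-refl i Sign.- = refl
  weight-refl i Sign.+ = refl

  weight-opposite : ∀ i s → weight i s (opposite s) ≡ m + suc m
  weight-opposite i Sign.- = refl
  weight-opposite i Sign.+ = refl

  weight-comm : ∀ i r s → weight i r s ≡ weight i s r
  weight-comm i r s = cong (if_then degree G i else (m + suc m))
    (does-⇔ (mk⇔ sym sym) (r Sign.≟ s) (s Sign.≟ r))

  weight-lower : ∀ i r s → degree G i ⊓ (m + suc m) ≤ weight i r s
  weight-lower i r s with does (r Sign.≟ s)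
  ... | true  = m⊓n≤m (degree G i) _
  ... | false = m⊓n≤n (degree G i) _

  cost : Configuration n → Fin n → Sign → ℕ
  cost x i s = mismatch x i s + weight i (lookup x i) s

  cost-keep : ∀ x i → cost x i (lookup x i) ≡ mismatch x i (lookup x i) + degree G i
  cost-keep x i = cong (mismatch x i _ +_) (weight-refl i (lookup x i))

  cost-flip : ∀ x i → cost x i (opposite (lookup x i)) ≡
                      mismatch x i (opposite (lookup x i)) + (m + suc m)
  cost-flip x i = cong (mismatch x i _ +_) (weight-opposite i (lookup x i))

  -- Once `D′` is split off both costs, keeping against flipping becomes `D + D` against
  -- `m + suc m`, and the threshold test on `D` decides it strictly.
  step-minimises-< : ∀ x i {s} → s ≢ lookup (step G (suc m) x) i →
                     cost x i (lookup (step G (suc m) x) i) < cost x i s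
  step-minimises-< x i {s} s≢ =
    subst (λ r → cost x i r < cost x i s) (sym lookup-step)
      (chosen (suc m ≤? op G x i) (s≢ ∘ λ eq → trans eq (sym lookup-step)))
    where
    open ≤-Reasoning
    a  = lookup x i
    D  = mismatch x i a
    D′ = mismatch x i (opposite a)

    -- Taking the decision as an argument lets `chosen` split on it and the conditional compute.
    next : Dec (suc m ≤ op G x i) → Sign
    next k≤op? = if does k≤op? then opposite a else a

    lookup-step : lookup (step G (suc m) x) i ≡ next (suc m ≤? op G x i)
    lookup-step = lookup∘tabulate _ i

    D+degree : D + degree G i ≡ D′ + (D + D)
    D+degree = begin-equality
      D + degree G i  ≡⟨ cong (D +_) (mismatch-opposite x i a) ⟨
      D + (D + D′)    ≡⟨ +-assoc D D D′ ⟨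
      D + D + D′      ≡⟨ +-comm (D + D) D′ ⟩
      D′ + (D + D)    ∎

    flip-cheaper : suc m ≤ D → cost x i (opposite a) < cost x i a
    flip-cheaper m<D = begin-strict
      cost x i (opposite a) ≡⟨ cost-flip x i ⟩
      -- One hypothesis serves twice: as `m < D` for the first summand and as `suc m ≤ D` for the
      -- second.
      D′ + (m + suc m)      <⟨ +-monoʳ-< D′ (+-mono-<-≤ m<D m<D) ⟩
      D′ + (D + D)          ≡⟨ D+degree ⟨
      D + degree G i        ≡⟨ cost-keep x i ⟨
      cost x i a            ∎

    keep-cheaper : D ≤ m → cost x i a < cost x i (opposite a)
    keep-cheaper D≤m = begin-strict
      cost x i a            ≡⟨ cost-keep x i ⟩
      D + degree G i        ≡⟨ D+degree ⟩
      D′ + (D + D)          <⟨ +-monoʳ-< D′ (+-mono-≤-< D≤m (s≤s D≤m)) ⟩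
      D′ + (m + suc m)      ≡⟨ cost-flip x i ⟨
      cost x i (opposite a) ∎

    chosen : ∀ k≤op? → s ≢ next k≤op? → cost x i (next k≤op?) < cost x i s
    chosen (yes k≤op) s≢next = subst (λ r → cost x i (opposite a) < cost x i r)
      (sym (trans (≢⇒≡opposite s≢next) (Sign.opposite-involutive a)))
      (flip-cheaper (subst (suc m ≤_) (op≡mismatch x i) k≤op))
    chosen (no k≰op) s≢next = subst (λ r → cost x i a < cost x i r)
      (sym (≢⇒≡opposite s≢next))
      (keep-cheaper (subst (_≤ m) (op≡mismatch x i) (s≤s⁻¹ (≰⇒> k≰op))))

  step-minimises : ∀ x i s → cost x i (lookup (step G (suc m) x) i) ≤ cost x i s
  step-minimises x i s with s Sign.≟ lookup (step G (suc m) x) i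
  ... | yes refl = ≤-refl
  ... | no s≢    = <⇒≤ (step-minimises-< x i s≢)

  -- A lower bound independent of the configuration; it cancels when the energies at two times are
  -- compared.
  baseCost : Fin n → ℕ
  baseCost i = degree G i ⊓ (m + suc m)

  baseCost≤cost : ∀ x i s → baseCost i ≤ cost x i s
  baseCost≤cost x i s = ≤-trans (weight-lower i (lookup x i) s) (m≤n+m _ (mismatch x i s))

  -- The minimal cost is below both the keeping and the flipping cost. Each is at most the degree
  -- plus its own weight, and addition distributes over the minimum of the two weights.
  step-cost≤ : ∀ x i → cost x i (lookup (step G (suc m) x) i) ≤ degree G i + baseCost i
  step-cost≤ x i = subst (cost x i (lookup (step G (suc m) x) i) ≤_)
    (sym (+-distribˡ-⊓ (degree G i) (degree G i) (m + suc m)))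
    (⊓-glb (≤-trans (step-minimises x i (lookup x i))
             (≤-trans (≤-reflexive (cost-keep x i)) (+-monoˡ-≤ _ (mismatch≤degree x i _))))
           (≤-trans (step-minimises x i (opposite (lookup x i)))
             (≤-trans (≤-reflexive (cost-flip x i)) (+-monoˡ-≤ _ (mismatch≤degree x i _)))))

  -- Symmetric total cost of a transition

  totalCost : Configuration n → Configuration n → ℕ
  totalCost x y = ∑[ i < n ] cost x i (lookup y i)

  totalCost-comm : ∀ x y → totalCost x y ≡ totalCost y x
  totalCost-comm x y = begin
    totalCost x y
      ≡⟨ ∑-distrib-+ (λ i → mismatch x i (lookup y i)) (λ i → weight i (lookup x i) (lookup y i)) ⟩
    (∑[ i < n ] mismatch x i (lookup y i)) + (∑[ i < n ] weight i (lookup x i) (lookup y i))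
      ≡⟨ cong₂ _+_ (∑-mismatch-comm x y)
                   (sum-cong-≗ λ i → weight-comm i (lookup x i) (lookup y i)) ⟩
    (∑[ i < n ] mismatch y i (lookup x i)) + (∑[ i < n ] weight i (lookup y i) (lookup x i))
      ≡⟨ ∑-distrib-+ (λ i → mismatch y i (lookup x i)) (λ i → weight i (lookup y i) (lookup x i)) ⟨
    totalCost y x ∎
    where open ≡-Reasoning

  -- Every vertex satisfies the weak inequality, and a vertex where `y` departs from the step makes
  -- the sum strict.
  totalCost-step-< : ∀ x y → y ≢ step G (suc m) x →
                     totalCost x (step G (suc m) x) < totalCost x y
  totalCost-step-< x y y≢ with lookup-≢ y≢
  ... | i , yᵢ≢ = sum-mono-< (λ j → step-minimises x j (lookup y j)) i (step-minimises-< x i yᵢ≢)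

  -- Decrease of energy along the orbit

  module _ (x₀ : Configuration n) where

    x : ℕ → Configuration n
    x = process G (suc m) x₀

    energy : ℕ → ℕ
    energy t = totalCost (x t) (x (suc t))

    -- From `x (suc t)`, the past configuration `x t` competes with the actual successor
    -- `x (2 + t)`; by symmetry its total cost is the previous energy.
    energy-decreases : ∀ t → x (2 + t) ≢ x t → energy (suc t) < energy t
    energy-decreases t x≢ = subst (energy (suc t) <_) (totalCost-comm (x (suc t)) (x t))
      (totalCost-step-< (x (suc t)) (x t) (x≢ ∘ sym))

    energy-bound : ∀ τ → (∀ t → t < τ → x (2 + t) ≢ x t) → τ + energy τ ≤ energy 0
    energy-bound zero    x≢ = ≤-refl
    energy-bound (suc τ) x≢ = begin
      suc τ + energy (suc τ)   ≡⟨ +-suc τ (energy (suc τ)) ⟨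
      τ + suc (energy (suc τ)) ≤⟨ +-monoʳ-≤ τ (energy-decreases τ (x≢ τ ≤-refl)) ⟩
      τ + energy τ             ≤⟨ energy-bound τ (λ t t<τ → x≢ t (m<n⇒m<1+n t<τ)) ⟩
      energy 0                 ∎
      where open ≤-Reasoning

    transient≤∑degree : ∀ τ → (∀ t → t < τ → x (2 + t) ≢ x t) → τ ≤ sum (degree G)
    transient≤∑degree τ x≢ = +-cancelʳ-≤ (sum baseCost) τ (sum (degree G)) (begin
      τ + sum baseCost                       ≤⟨ +-monoʳ-≤ τ (sum-mono-≤ λ i → baseCost≤cost (x τ) i _) ⟩
      τ + energy τ                           ≤⟨ energy-bound τ x≢ ⟩
      -- `x 1` is the step of `x₀`, so the upper bound on minimal costs applies at every vertex.
      energy 0                               ≤⟨ sum-mono-≤ (step-cost≤ x₀) ⟩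
      ∑[ i < n ] (degree G i + baseCost i)   ≡⟨ ∑-distrib-+ (degree G) baseCost ⟩
      sum (degree G) + sum baseCost          ∎)
      where open ≤-Reasoning

    transientLength≤n*Δ : transientLength G (suc m) x₀ ≤ n * Δ G
    transientLength≤n*Δ = ≤-trans (transient≤∑degree _ no-return) (sum-≤-* (Δ G) (degree≤Δ G))
      where
      open IsPeriodTransient (periodLength-transientLength G (suc m) x₀)
      no-return : ∀ t → t < transientLength G (suc m) x₀ → x (2 + t) ≢ x t
      -- Before the transient ends no configuration recurs after any positive delay, in particular
      -- after 2, whatever the period is.
      no-return t t<τ = subst (λ u → x u ≢ x t) (+-comm t 2) (minimal t 2 (s≤s z≤n) (inj₁ t<τ))

corollary5 : ∀ (n : ℕ) → 1 ≤ n → (G : Graph n) (k : ℕ) → 1 ≤ k →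
    (x₀ : Configuration n) →
    transientLength G k x₀ ≤ n * (Δ G + 1) ∸ 1
corollary5 n 1≤n G (suc m) _ x₀ = begin
  transientLength G (suc m) x₀  ≤⟨ transientLength≤n*Δ G m x₀ ⟩
  -- The bound obtained is smaller than the claimed one by `n ∸ 1`; `1 ≤ n` then lets the truncated
  -- subtraction move outside the sum.
  n * Δ G                       ≤⟨ m≤m+n (n * Δ G) (n ∸ 1) ⟩
  n * Δ G + (n ∸ 1)             ≡⟨ +-∸-assoc (n * Δ G) 1≤n ⟨
  n * Δ G + n ∸ 1               ≡⟨ cong (λ r → n * Δ G + r ∸ 1) (*-identityʳ n) ⟨
  n * Δ G + n * 1 ∸ 1           ≡⟨ cong (_∸ 1) (*-distribˡ-+ n (Δ G) 1) ⟨
  n * (Δ G + 1) ∸ 1             ∎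
  where open ≤-Reasoning
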